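{- There is an absolute constant $c>0$ such that the following holds. For every instance of the paging problem (pages $[n]$, cache size $k<n$, request sequence $\sigma\in[n]^T$, initial cache configuration of $k$ pages used by both $\mathtt{Sim}$ and $\mathtt{FitF}$) and every NAT prediction sequence $(p_t)_{t\in[T]}$ with $p_t\in(t,T+n]$, the algorithm $\mathtt{Sim}$ run with these predictions satisfies $$\operatorname{cost}(\mathtt{Sim})-\mathtt{OPT}\le c\,(\eta+k),$$ where $\eta=|\{t\in[T]: p_t\neq A_t(\sigma_t)\}|$.
   Context: Paging: $n$ pages, cache of exactly $k<n$ pages, request sequence $\sigma=(\sigma_t)_{t\in[T]}\in[n]^T$ revealed online. A cache miss at round $t$ occurs if $\sigma_t$ is not in the current cache $C_t$; the algorithm then evicts one page of $C_t$ and brings in $\sigma_t$ (algorithms are lazy: no changes on hits). The cost is the number of cache misses. The sequence is augmented with virtual requests $\sigma_{T+i}=i$ for $i\in[n]$, and the next arrival time (NAT) of page $i$ after time $t$ is $A_t(i)=\min\{t'>t:\sigma_{t'}=i\}$. $\mathtt{FitF}$ evicts on a miss the page $i\in C_t$ maximizing $A_t(i)$; it is optimal and $\mathtt{OPT}$ denotes its cost. A NAT predictor outputs at each round $t$ (after $\sigma_t$ is revealed) a prediction $p_t\in(t,T+n]$ of $A_t(\sigma_t)$. Algorithm $\mathtt{Sim}$: fix an integer $Z>T+n$. Define remedy predictions $\hat p_t(i)$ for $t\in[T]$, $i\in[n]$: $\hat p_1(i)=p_1$ if $i=\sigma_1$ and $\hat p_1(i)=Z+1$ otherwise; for $t\ge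 2$, $\hat p_t(i)=p_t$ if $i=\sigma_t$; $\hat p_t(i)=Z$ if $\hat p_{t-1}(i)\le t$, $i\ne\sigma_t$ and $\hat p_{t-1}(i)\le \hat p_{t-1}(\sigma_t)<Z$; and $\hat p_t(i)=\hat p_{t-1}(i)$ otherwise. On a cache miss at round $t$, $\mathtt{Sim}$ evicts a page $i$ of its cache maximizing $\hat p_t(i)$ (ties broken arbitrarily). -}

module Defs where

open import Data.Nat using (ℕ; zero; suc; _+_; _∸_; _≤_; _<_; _≤ᵇ_; _<ᵇ_; _≤?_; _<?_)
open import Data.Bool using (Bool; true; false; if_then_else_; _∧_)
open import Data.Fin using (Fin; fromℕ<; _≟_)
open import Data.Fin.Subset using (Subset; _∈_; _∉_; ∣_∣; inside; outside)
open import Data.Vec using (_[_]≔_)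
open import Data.Maybe using (Maybe; just; nothing)
open import Data.List using (List; map; upTo; length; filterᵇ)
open import Data.Product using (Σ; _×_)
open import Data.Sum using (_⊎_)
open import Relation.Nullary using (does; yes; no)
open import Relation.Binary.PropositionalEquality using (_≡_)

-- Conventions: times are 1-indexed natural numbers as in the paper; the
-- request sequence is a function σ : ℕ → Fin n of which only σ 1 … σ T
-- is ever used.  Page i ∈ [n] of the paper is the element (i-1) of Fin n.

rounds : ℕ → List ℕ
rounds T = map suc (upTo T)

countRounds : ℕ → (ℕ → Bool) → ℕ
countRounds T b = length (filterᵇ b (rounds T))

aug : (n T : ℕ) → (ℕ → Fin n) → ℕ → Maybe (Fin n)
aug n T σ t with 1 ≤? t | t ≤? T
... | yes _ | yes _ = just (σ t)
... | yes _ | no _ with t ∸ suc T <? n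
...   | yes lt = just (fromℕ< lt)
...   | no _ = nothing
aug n T σ t | no _ | _ = nothing

matches : {n : ℕ} → Maybe (Fin n) → Fin n → Bool
matches (just j) i = does (j ≟ i)
matches nothing i = false

-- first time s' ∈ {s, …, s+f-1} with aug s' = i (default s+f, never reached in use)
searchFrom : (n T : ℕ) → (ℕ → Fin n) → Fin n → ℕ → ℕ → ℕ
searchFrom n T σ i s zero = s
searchFrom n T σ i s (suc f) =
  if matches (aug n T σ s) i then s else searchFrom n T σ i (suc s) f

NAT : (n T : ℕ) → (ℕ → Fin n) → ℕ → Fin n → ℕ
NAT n T σ t i = searchFrom n T σ i (suc t) (T + n)

-- remedy predictions \hat p_t(i) of Sim (Z the fixed integer > T + n)
-- (the value at t = 0 is never used)
-- one update step: t is the current round, σt = σ_t, pt = p_t,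
-- prev = \hat p_{t-1}
hatpStep : (n : ℕ) → ℕ → ℕ → Fin n → ℕ → (Fin n → ℕ) → Fin n → ℕ
hatpStep n Z t σt pt prev i =
  if does (i ≟ σt)
  then pt
  else (if (prev i ≤ᵇ t) ∧ (prev i ≤ᵇ prev σt) ∧ (prev σt <ᵇ Z)
        then Z else prev i)

hatp : (n : ℕ) → (ℕ → Fin n) → (ℕ → ℕ) → ℕ → ℕ → Fin n → ℕ
hatp n σ p Z zero i = suc Z
hatp n σ p Z (suc zero) i = if does (i ≟ σ 1) then p 1 else suc Z
hatp n σ p Z (suc (suc t)) i =
  hatpStep n Z (suc (suc t)) (σ (suc (suc t))) (p (suc (suc t))) (hatp n σ p Z (suc t)) i

-- One round t of a lazy paging algorithm whose eviction rule is
-- "on a miss, evict a page of the cache maximising score t" (ties arbitrary).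
-- C t is the cache content at the start of round t.
LazyStep : (n : ℕ) → (ℕ → Fin n) → (ℕ → Fin n → ℕ) → (ℕ → Subset n) → ℕ → Set
LazyStep n σ score C t =
  (σ t ∈ C t × C (suc t) ≡ C t)
  ⊎ (σ t ∉ C t × Σ (Fin n) λ e → e ∈ C t
       × (∀ j → j ∈ C t → score t j ≤ score t e)
       × C (suc t) ≡ ((C t [ e ]≔ outside) [ σ t ]≔ inside))

IsRun : (n T : ℕ) → (ℕ → Fin n) → (ℕ → Fin n → ℕ) → Subset n → (ℕ → Subset n) → Set
IsRun n T σ score C₀ C =
  C 1 ≡ C₀ × (∀ t → 1 ≤ t → t ≤ T → LazyStep n σ score C t)

inCache : {n : ℕ} → Subset n → Fin n → Bool
inCache (b Data.Vec.∷ _) Fin.zero = b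
inCache (_ Data.Vec.∷ bs) (Fin.suc i) = inCache bs i

cost : (n T : ℕ) → (ℕ → Fin n) → (ℕ → Subset n) → ℕ
cost n T σ C = countRounds T (λ t → if inCache (C t) (σ t) then false else true)

IsSimRun : (n T : ℕ) → (ℕ → Fin n) → (ℕ → ℕ) → ℕ → Subset n → (ℕ → Subset n) → Set
IsSimRun n T σ p Z = IsRun n T σ (hatp n σ p Z)

IsFitFRun : (n T : ℕ) → (ℕ → Fin n) → Subset n → (ℕ → Subset n) → Set
IsFitFRun n T σ = IsRun n T σ (NAT n T σ)

eta : (n T : ℕ) → (ℕ → Fin n) → (ℕ → ℕ) → ℕ
eta n T σ p = countRounds T (λ t → if does (p t Data.Nat.≟ NAT n T σ t (σ t)) then false else true)

{-# OPTIONS --safe #-}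
module Submission where

-- Write ĥ for the remedy predictions, and o x, s x for the number of pages of
-- value ĥ < x in the caches of FitF and Sim.  If every request has the strictly
-- smallest value, the exchange argument for Belady's rule shows that
-- max over x of (o x − s x), which is never negative, drops by one whenever Sim
-- misses and FitF hits, and grows, by at most one, only when FitF misses and
-- Sim hits.
-- An exactly predicted request at round t has value t and resets every overdue
-- page to Z, hence it is such a request; a request of a page never seen before
-- and outside the initial cache is a miss for both algorithms.  All other
-- requests end the lifetime of a wrong prediction or are first requests of
-- initially cached pages, so there are at most η + k of them, each shifting the
-- balance by at most 2; every reset to Z concerns a wrong prediction, happens
-- at most once in its lifetime, and shifts the balance by at most 1.
-- In total cost(Sim) ≤ OPT + 3η + 2k.

open import Defs
open import Data.Bool using (Bool; true; false; if_then_else_)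
open import Data.Bool.Properties using (T?)
open import Data.Empty using (⊥-elim)
open import Data.Fin using (Fin; zero; suc; toℕ; punchIn; _≟_)
open import Data.Fin.Properties using (punchInᵢ≢i; toℕ<n; toℕ-fromℕ<; toℕ-injective)
open import Data.Fin.Subset using (Subset; ∣_∣; _∈_; _∉_; inside; outside)
open import Data.List using (_∷_; []; length; filter; map; upTo; _++_)
open import Data.List.Properties using (upTo-∷ʳ; map-++; filter-++; length-++)
open import Data.Maybe using (just)
open import Data.Nat using (ℕ; zero; suc; _+_; _*_; _∸_; _≤_; _<_; z≤n; s≤s; _≤?_; _<?_)
open import Data.Nat.Properties hiding (_≟_)
open import Data.Nat.Tactic.RingSolver using (solve-∀)
open import Data.Product using (Σ; _×_; _,_; proj₁; proj₂)
open import Data.Sum using (_⊎_; inj₁; inj₂)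
open import Data.Vec using (lookup; _[_]≔_; []; _∷_)
open import Data.Vec.Properties using ([]=⇒lookup; lookup⇒[]=; lookup∘update; lookup∘update′)
open import Function using (_∘_)
open import Relation.Binary.PropositionalEquality using (_≡_; _≢_; refl; sym; trans; cong; cong₂; subst; module ≡-Reasoning)
open import Relation.Nullary using (Dec; does; yes; no; ¬_)
open import Relation.Nullary.Decidable using (_×-dec_; dec-true; dec-false)

open import Algebra.Properties.CommutativeMonoid.Sum +-0-commutativeMonoid using (sum; sum-remove; sum-cong-≗; ∑-distrib-+; sum-replicate-zero)

+-swapʳ : ∀ a b c → a + b + c ≡ a + c + b
+-swapʳ = solve-∀

-- Sums over Fin n

sum-mono : ∀ {n} {f g : Fin n → ℕ} → (∀ j → f j ≤ g j) → sum f ≤ sum g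
sum-mono {zero}  f≤g = z≤n
sum-mono {suc n} f≤g = +-mono-≤ (f≤g zero) (sum-mono (f≤g ∘ suc))

-- The terms at `i` are added crosswise, which compares the sums off `i` without truncated
-- subtraction.
sum-mono-except : ∀ {n} {f g : Fin n → ℕ} i → (∀ j → j ≢ i → f j ≤ g j) →
                  sum f + g i ≤ sum g + f i
sum-mono-except {suc n} {f} {g} i f≤g = begin
  sum f + g i             ≡⟨ cong (_+ g i) (sum-remove {i = i} f) ⟩
  f i + sum f∖i + g i     ≤⟨ +-monoˡ-≤ (g i) (+-monoʳ-≤ (f i) (sum-mono λ j → f≤g (punchIn i j) (punchInᵢ≢i i j))) ⟩
  f i + sum g∖i + g i     ≡⟨ rearrange (f i) (sum g∖i) (g i) ⟩
  g i + sum g∖i + f i     ≡⟨ cong (_+ f i) (sum-remove {i = i} g) ⟨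
  sum g + f i             ∎
  where
  open ≤-Reasoning
  f∖i = f ∘ punchIn i
  g∖i = g ∘ punchIn i
  rearrange : ∀ a b c → a + b + c ≡ c + b + a
  rearrange = solve-∀

sum-cong-except : ∀ {n} {f g : Fin n → ℕ} i → (∀ j → j ≢ i → f j ≡ g j) →
                  sum f + g i ≡ sum g + f i
sum-cong-except i f≡g = ≤-antisym
  (sum-mono-except i λ j j≢i → ≤-reflexive (f≡g j j≢i))
  (sum-mono-except i λ j j≢i → ≤-reflexive (sym (f≡g j j≢i)))

term≤sum : ∀ {n} (f : Fin n → ℕ) i → f i ≤ sum f
term≤sum {suc n} f i = subst (f i ≤_) (sym (sum-remove {i = i} f)) (m≤m+n (f i) _)

sum-zero : ∀ {n} {f : Fin n → ℕ} → (∀ j → f j ≡ 0) → sum f ≡ 0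
sum-zero {n} f≡0 = trans (sum-cong-≗ f≡0) (sum-replicate-zero n)

-- Indicators

ind : Bool → ℕ
ind b = if b then 1 else 0

ind≤1 : ∀ b → ind b ≤ 1
ind≤1 true  = ≤-refl
ind≤1 false = z≤n

if-dec : ∀ {P A : Set} (d : Dec P) (x y : A) →
         ((if does d then x else y) ≡ x × P) ⊎ ((if does d then x else y) ≡ y × ¬ P)
if-dec (yes p) x y = inj₁ (refl , p)
if-dec (no ¬p) x y = inj₂ (refl , ¬p)

-- Used as a weight, this makes `weight` count the cached pages whose value lies under a threshold.
below : ℕ → ℕ → ℕ
below x a = ind (does (a <? x))

below≤1 : ∀ x a → below x a ≤ 1
below≤1 x a = ind≤1 (does (a <? x))

<⇒below≡1 : ∀ {x a} → a < x → below x a ≡ 1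
<⇒below≡1 {x} {a} a<x = cong ind (dec-true (a <? x) a<x)

≥⇒below≡0 : ∀ {x a} → x ≤ a → below x a ≡ 0
≥⇒below≡0 {x} {a} x≤a = cong ind (dec-false (a <? x) (≤⇒≯ x≤a))

below-anti : ∀ x {a b} → a ≤ b → below x b ≤ below x a
below-anti x {a} {b} a≤b with <-≤-connex b x
... | inj₁ b<x rewrite <⇒below≡1 b<x | <⇒below≡1 (≤-<-trans a≤b b<x) = ≤-refl
... | inj₂ x≤b rewrite ≥⇒below≡0 x≤b = z≤n

-- Weighted caches

inCache≡lookup : ∀ {n} (C : Subset n) j → inCache C j ≡ lookup C j
inCache≡lookup (_ ∷ _) zero    = refl
inCache≡lookup (_ ∷ C) (suc j) = inCache≡lookup C j

∈⇒inCache : ∀ {n} {C : Subset n} {j} → j ∈ C → inCache C j ≡ true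
∈⇒inCache {C = C} {j} j∈C = trans (inCache≡lookup C j) ([]=⇒lookup j∈C)

inCache⇒∈ : ∀ {n} {C : Subset n} {j} → inCache C j ≡ true → j ∈ C
inCache⇒∈ {C = C} {j} eq = lookup⇒[]= j C (trans (sym (inCache≡lookup C j)) eq)

∉⇒inCache : ∀ {n} {C : Subset n} {j} → j ∉ C → inCache C j ≡ false
∉⇒inCache {C = C} {j} j∉C with inCache C j in eq
... | false = refl
... | true  = ⊥-elim (j∉C (inCache⇒∈ eq))

inCache-update : ∀ {n} (C : Subset n) i b → inCache (C [ i ]≔ b) i ≡ b
inCache-update C i b = trans (inCache≡lookup (C [ i ]≔ b) i) (lookup∘update i C b)

inCache-update′ : ∀ {n} (C : Subset n) {i j} b → j ≢ i → inCache (C [ i ]≔ b) j ≡ inCache C j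
inCache-update′ C {i} {j} b j≢i =
  trans (inCache≡lookup (C [ i ]≔ b) j) (trans (lookup∘update′ j≢i C b) (sym (inCache≡lookup C j)))

∈∉⇒≢ : ∀ {n} {C : Subset n} {i j} → inCache C j ≡ true → inCache C i ≡ false → j ≢ i
∈∉⇒≢ j∈C i∉C refl with trans (sym i∉C) j∈C
... | ()

mem : ∀ {n} → Subset n → Fin n → ℕ
mem C j = ind (inCache C j)

weight : ∀ {n} → Subset n → (Fin n → ℕ) → ℕ
weight C w = sum (λ j → mem C j * w j)

size : ∀ {n} → Subset n → ℕ
size C = weight C (λ _ → 1)

size≡∣∣ : ∀ {n} (C : Subset n) → size C ≡ ∣ C ∣
size≡∣∣ []          = refl
size≡∣∣ (true  ∷ C) = cong suc (size≡∣∣ C)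
size≡∣∣ (false ∷ C) = size≡∣∣ C

weight-cong : ∀ {n} (C : Subset n) {w w′ : Fin n → ℕ} →
              (∀ j → inCache C j ≡ true → w j ≡ w′ j) → weight C w ≡ weight C w′
weight-cong C {w} {w′} eq = sum-cong-≗ pointwise
  where
  pointwise : ∀ j → mem C j * w j ≡ mem C j * w′ j
  pointwise j with inCache C j in j∈C
  ... | true  = cong (1 *_) (eq j j∈C)
  ... | false = refl

weight-zero : ∀ {n} (C : Subset n) {w : Fin n → ℕ} →
              (∀ j → inCache C j ≡ true → w j ≡ 0) → weight C w ≡ 0
weight-zero C {w} eq =
  trans (weight-cong C {w} {λ _ → 0} eq) (sum-zero λ j → *-zeroʳ (mem C j))

mem≡1 : ∀ {n} {C : Subset n} {j} → inCache C j ≡ true → ∀ a → mem C j * a ≡ a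
mem≡1 j∈C a = trans (cong (λ b → ind b * a) j∈C) (*-identityˡ a)

mem≡0 : ∀ {n} {C : Subset n} {j} → inCache C j ≡ false → ∀ a → mem C j * a ≡ 0
mem≡0 j∉C a = cong (λ b → ind b * a) j∉C

term≤weight : ∀ {n} (C : Subset n) (w : Fin n → ℕ) {j} → inCache C j ≡ true → w j ≤ weight C w
term≤weight C w {j} j∈C =
  subst (_≤ weight C w) (mem≡1 {C = C} j∈C (w j)) (term≤sum (λ j → mem C j * w j) j)

-- Pages other than `e` weigh at most one each, while `e` keeps its exact weight.
weight≤size : ∀ {n} (C : Subset n) {w : Fin n → ℕ} → (∀ j → w j ≤ 1) →
              ∀ {e} → inCache C e ≡ true → weight C w + 1 ≤ size C + w e
weight≤size C {w} w≤1 {e} e∈C =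
  subst (λ b → weight C w + b ≤ size C + w e) (mem≡1 {C = C} e∈C 1)
    (subst (λ b → weight C w + mem C e * 1 ≤ size C + b) (mem≡1 {C = C} e∈C (w e))
      (sum-mono-except e λ j _ → *-monoʳ-≤ (mem C j) (w≤1 j)))

-- Serving a request

missed : ∀ {n} → Subset n → Fin n → ℕ
missed C i = ind (if inCache C i then false else true)

-- A hit is the exchange of the requested page i with itself, so that
-- hits and misses obey the same weight balance.
record Serve {n} (C C′ : Subset n) (i : Fin n) (score : Fin n → ℕ) : Set where
  field
    victim    : Fin n
    victim∈   : inCache C victim ≡ true
    exchange  : ∀ (w w′ : Fin n → ℕ) → (∀ j → j ≢ i → w j ≡ w′ j) →
                weight C′ w′ + w victim ≡ weight C w + w′ i
    stays-out : ∀ {j} → j ≢ i → inCache C j ≡ false → inCache C′ j ≡ false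
    outcome   : (inCache C i ≡ true × missed C i ≡ 0 × victim ≡ i)
              ⊎ (inCache C i ≡ false × missed C i ≡ 1 ×
                 (∀ j → inCache C j ≡ true → score j ≤ score victim))

serve-hit : ∀ {n} {C : Subset n} {i score} → inCache C i ≡ true → Serve C C i score
serve-hit {C = C} {i} i∈C = record
  { victim    = i
  ; victim∈   = i∈C
  ; exchange  = λ w w′ w≡w′ →
      trans (cong (weight C w′ +_) (sym (mem≡1 {C = C} i∈C (w i))))
        (trans (sum-cong-except i λ j j≢i → cong (mem C j *_) (sym (w≡w′ j j≢i)))
          (cong (weight C w +_) (mem≡1 {C = C} i∈C (w′ i))))
  ; stays-out = λ _ j∉C → j∉C
  ; outcome   = inj₁ (i∈C , cong (λ b → ind (if b then false else true)) i∈C , refl)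
  }

serve-miss : ∀ {n} {C : Subset n} {i e score} → inCache C i ≡ false → inCache C e ≡ true →
             (∀ j → inCache C j ≡ true → score j ≤ score e) →
             Serve C ((C [ e ]≔ outside) [ i ]≔ inside) i score
serve-miss {n} {C} {i} {e} i∉C e∈C max = record
  { victim    = e
  ; victim∈   = e∈C
  ; exchange  = exchange
  ; stays-out = stays-out
  ; outcome   = inj₂ (i∉C , cong (λ b → ind (if b then false else true)) i∉C , max)
  }
  where
  D C′ : Subset n
  D  = C [ e ]≔ outside
  C′ = D [ i ]≔ inside

  D-out : ∀ {j} → inCache C j ≡ false → inCache D j ≡ false
  D-out {j} j∉C with j ≟ e
  ... | yes refl = inCache-update C e outside
  ... | no j≢e   = trans (inCache-update′ C outside j≢e) j∉C

  stays-out : ∀ {j} → j ≢ i → inCache C j ≡ false → inCache C′ j ≡ false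
  stays-out j≢i j∉C = trans (inCache-update′ D inside j≢i) (D-out j∉C)

  evict : ∀ w → weight C w ≡ weight D w + w e
  evict w = begin
    weight C w                   ≡⟨ +-identityʳ _ ⟨
    -- `e` weighs nothing in `D`; adding this zero gives the shape of `sum-cong-except`.
    weight C w + 0               ≡⟨ cong (weight C w +_) (mem≡0 {C = D} (inCache-update C e outside) (w e)) ⟨
    weight C w + mem D e * w e   ≡⟨ sum-cong-except e (λ j j≢e → cong (λ b → ind b * w j) (sym (inCache-update′ C outside j≢e))) ⟩
    weight D w + mem C e * w e   ≡⟨ cong (weight D w +_) (mem≡1 {C = C} e∈C (w e)) ⟩
    weight D w + w e             ∎
    where open ≡-Reasoning

  load : ∀ w w′ → (∀ j → j ≢ i → w j ≡ w′ j) → weight C′ w′ ≡ weight D w + w′ i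
  load w w′ w≡w′ = begin
    weight C′ w′                   ≡⟨ +-identityʳ _ ⟨
    weight C′ w′ + 0               ≡⟨ cong (weight C′ w′ +_) (mem≡0 {C = D} (D-out i∉C) (w i)) ⟨
    weight C′ w′ + mem D i * w i   ≡⟨ sum-cong-except i (λ j j≢i → cong₂ (λ b a → ind b * a) (inCache-update′ D inside j≢i) (sym (w≡w′ j j≢i))) ⟩
    weight D w + mem C′ i * w′ i   ≡⟨ cong (weight D w +_) (mem≡1 {C = C′} (inCache-update D i inside) (w′ i)) ⟩
    weight D w + w′ i              ∎
    where open ≡-Reasoning

  exchange : ∀ (w w′ : Fin n → ℕ) → (∀ j → j ≢ i → w j ≡ w′ j) →
             weight C′ w′ + w e ≡ weight C w + w′ i
  exchange w w′ w≡w′ = trans (cong (_+ w e) (load w w′ w≡w′))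
    (trans (+-swapʳ (weight D w) (w′ i) (w e)) (cong (_+ w′ i) (sym (evict w))))

lazyStep⇒serve : ∀ {n} (σ : ℕ → Fin n) score C t → LazyStep n σ score C t →
                 Serve (C t) (C (suc t)) (σ t) (score t)
lazyStep⇒serve σ score C t (inj₁ (i∈C , eq)) =
  subst (λ C′ → Serve (C t) C′ (σ t) (score t)) (sym eq) (serve-hit (∈⇒inCache i∈C))
lazyStep⇒serve σ score C t (inj₂ (i∉C , e , e∈C , max , eq)) =
  subst (λ C′ → Serve (C t) C′ (σ t) (score t)) (sym eq)
    (serve-miss (∉⇒inCache i∉C) (∈⇒inCache e∈C) λ j j∈C → max j (inCache⇒∈ j∈C))

-- Under the constant weight one, victim and request cancel in the exchange identity.
size-serve : ∀ {n} {C C′ : Subset n} {i score} → Serve C C′ i score → size C′ ≡ size C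
size-serve s = +-cancelʳ-≡ 1 _ _ (Serve.exchange s (λ _ → 1) (λ _ → 1) (λ _ _ → refl))

-- One round of the comparison of two caches

-- `q` and `h` are the values before and after the prediction of the request `i` is renewed. `L` and
-- `K` stand for everything in the invariant besides the two weighted caches.
module _ {n : ℕ} (S S′ O O′ : Subset n) (i : Fin n) (q h : Fin n → ℕ) (scoreO : Fin n → ℕ)
         (q≡h : ∀ j → j ≢ i → q j ≡ h j)
         (serveS : Serve S S′ i h) (serveO : Serve O O′ i scoreO)
         (sizes : size O ≡ size S)
         (L K : ℕ)
         (inv : ∀ x → L + weight O (below x ∘ q) ≤ K + weight S (below x ∘ q))
  where

  private
    module 𝕊 = Serve serveS
    module 𝕆 = Serve serveO

    eS eO : Fin n
    eS = 𝕊.victim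
    eO = 𝕆.victim

    agree : ∀ x j → j ≢ i → below x (q j) ≡ below x (h j)
    agree x j j≢i = cong (below x) (q≡h j j≢i)

  -- The new value of `i` enters both caches alike and cancels, so only the old values of the two
  -- victims shift the invariant.
  balance : ∀ x → L + weight O′ (below x ∘ h) + below x (q eO)
                ≤ K + weight S′ (below x ∘ h) + below x (q eS)
  balance x = begin
    L + o′ + below x (q eO)      ≡⟨ +-assoc L _ _ ⟩
    L + (o′ + below x (q eO))    ≡⟨ cong (L +_) (𝕆.exchange _ _ (agree x)) ⟩
    L + (o + below x (h i))      ≡⟨ +-assoc L _ _ ⟨
    L + o + below x (h i)        ≤⟨ +-monoˡ-≤ _ (inv x) ⟩
    K + s + below x (h i)        ≡⟨ +-assoc K _ _ ⟩
    K + (s + below x (h i))      ≡⟨ cong (K +_) (𝕊.exchange _ _ (agree x)) ⟨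
    K + (s′ + below x (q eS))    ≡⟨ +-assoc K _ _ ⟨
    K + s′ + below x (q eS)      ∎
    where
    open ≤-Reasoning
    o  = weight O (below x ∘ q)
    o′ = weight O′ (below x ∘ h)
    s  = weight S (below x ∘ q)
    s′ = weight S′ (below x ∘ h)

  -- No value lies under threshold 0, so the count of `S` vanishes there.
  L≤K : L ≤ K
  L≤K = begin
    L                              ≡⟨ +-identityʳ L ⟨
    L + 0                          ≤⟨ +-monoʳ-≤ L z≤n ⟩
    L + weight O (below 0 ∘ q)     ≤⟨ inv 0 ⟩
    K + weight S (below 0 ∘ q)     ≡⟨ cong (K +_) (weight-zero S {below 0 ∘ q} λ j _ → ≥⇒below≡0 {0} {q j} z≤n) ⟩
    K + 0                          ≡⟨ +-identityʳ K ⟩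
    K                              ∎
    where open ≤-Reasoning

  -- If S evicts a page of value < x, then all of its pages have value < x,
  -- so S′ has as many pages below x as any cache of its size holding i.
  saturated : inCache S i ≡ false → (∀ j → inCache S j ≡ true → h j ≤ h eS) →
              ∀ x → q eS < x → weight O′ (below x ∘ h) ≤ weight S′ (below x ∘ h)
  saturated i∉S max x eS<x = +-cancelʳ-≤ (below x (q eO) + 1) _ _ (begin
    o′ + (below x (q eO) + 1)              ≡⟨ +-assoc o′ _ 1 ⟨
    o′ + below x (q eO) + 1                ≡⟨ cong (_+ 1) (𝕆.exchange _ _ (agree x)) ⟩
    o + below x (h i) + 1                  ≡⟨ +-swapʳ o _ 1 ⟩
    o + 1 + below x (h i)                  ≤⟨ +-monoˡ-≤ _ (weight≤size O (λ j → below≤1 x (q j)) 𝕆.victim∈) ⟩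
    size O + below x (q eO) + below x (h i) ≡⟨ cong (λ m → m + below x (q eO) + below x (h i)) (trans sizes (sym full)) ⟩
    s + below x (q eO) + below x (h i)      ≡⟨ +-swapʳ s _ _ ⟩
    s + below x (h i) + below x (q eO)      ≡⟨ cong (_+ below x (q eO)) (𝕊.exchange _ _ (agree x)) ⟨
    s′ + below x (q eS) + below x (q eO)    ≡⟨ cong (λ m → s′ + m + below x (q eO)) (<⇒below≡1 eS<x) ⟩
    s′ + 1 + below x (q eO)                 ≡⟨ +-swapʳ s′ 1 _ ⟩
    s′ + below x (q eO) + 1                 ≡⟨ +-assoc s′ _ 1 ⟩
    s′ + (below x (q eO) + 1)               ∎)
    where
    open ≤-Reasoning
    o  = weight O (below x ∘ q)
    o′ = weight O′ (below x ∘ h)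
    s  = weight S (below x ∘ q)
    s′ = weight S′ (below x ∘ h)
    full : s ≡ size S
    full = weight-cong S λ j j∈S → <⇒below≡1 (≤-<-trans
      (subst (_≤ q eS) (sym (q≡h j (∈∉⇒≢ {C = S} j∈S i∉S)))
        (subst (h j ≤_) (sym (q≡h eS (∈∉⇒≢ {C = S} 𝕊.victim∈ i∉S))) (max j j∈S))) eS<x)

  -- At the threshold just above `q i` only `i` can be counted, and `O` holds it while `S` does not.
  gap : inCache S i ≡ false → inCache O i ≡ true → (∀ j → j ≢ i → q i < q j) → L + 1 ≤ K
  gap i∉S i∈O min = begin
    L + 1                                 ≡⟨ cong (L +_) (<⇒below≡1 (n<1+n (q i))) ⟨
    L + below x (q i)                     ≤⟨ +-monoʳ-≤ L (term≤weight O (below x ∘ q) i∈O) ⟩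
    L + weight O (below x ∘ q)            ≤⟨ inv x ⟩
    K + weight S (below x ∘ q)            ≡⟨ cong (K +_) (weight-zero S none) ⟩
    K + 0                                 ≡⟨ +-identityʳ K ⟩
    K                                     ∎
    where
    open ≤-Reasoning
    x = suc (q i)
    none : ∀ j → inCache S j ≡ true → below x (q j) ≡ 0
    none j j∈S = ≥⇒below≡0 (min j (∈∉⇒≢ {C = S} j∈S i∉S))

  -- `b` is the credit spent on this round. The critical case is a miss of `S` alone: two credits
  -- pay for the miss and the shift by the victim, a miss of `O` excludes the case, and strict
  -- minimality of `i` makes it free.
  round : ∀ {b} → 2 ≤ b ⊎ inCache O i ≡ false ⊎ (∀ j → j ≢ i → q i < q j) → ∀ x →
          L + missed S i + weight O′ (below x ∘ h) ≤ K + missed O i + b + weight S′ (below x ∘ h)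
  round {b} safe x = by-cases 𝕊.outcome 𝕆.outcome
    where
    open ≤-Reasoning
    o  = weight O (below x ∘ q)
    o′ = weight O′ (below x ∘ h)
    s  = weight S (below x ∘ q)
    s′ = weight S′ (below x ∘ h)

    Goal : ℕ → ℕ → Set
    Goal mS mO = L + mS + o′ ≤ K + mO + b + s′

    from-dominance : ∀ mS mO → L + mS ≤ K + mO + b → o′ ≤ s′ → Goal mS mO
    from-dominance _ _ = +-mono-≤

    from-balance : ∀ mS mO {u v} → below x (q eO) ≡ u → below x (q eS) ≡ v →
                   mS + v ≤ u + (mO + b) → Goal mS mO
    from-balance mS mO {u} {v} refl refl le = +-cancelʳ-≤ u _ _ (begin
      L + mS + o′ + u        ≡⟨ r₁ L mS o′ u ⟩
      L + o′ + u + mS        ≤⟨ +-monoˡ-≤ mS (balance x) ⟩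
      K + s′ + v + mS        ≡⟨ r₂ K s′ v mS ⟩
      K + s′ + (mS + v)      ≤⟨ +-monoʳ-≤ (K + s′) le ⟩
      K + s′ + (u + (mO + b)) ≡⟨ r₃ K s′ u mO b ⟩
      K + mO + b + s′ + u    ∎)
      where
      r₁ : ∀ L m o u → L + m + o + u ≡ L + o + u + m
      r₁ = solve-∀
      r₂ : ∀ K s v m → K + s + v + m ≡ K + s + (m + v)
      r₂ = solve-∀
      r₃ : ∀ K s u m b → K + s + (u + (m + b)) ≡ K + m + b + s + u
      r₃ = solve-∀

    -- The only round in which S pays and O does not: it is free when i has
    -- the strictly smallest value, since then i witnesses an advantage of O.
    S-only : inCache S i ≡ false → (∀ j → inCache S j ≡ true → h j ≤ h eS) →
             inCache O i ≡ true → eO ≡ i →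
             2 ≤ b ⊎ inCache O i ≡ false ⊎ (∀ j → j ≢ i → q i < q j) → Goal 1 0
    S-only i∉S max i∈O eO≡i (inj₁ 2≤b) =
      from-balance 1 0 refl refl (≤-trans (+-monoʳ-≤ 1 (below≤1 x (q eS))) (≤-trans 2≤b (m≤n+m b _)))
    S-only i∉S max i∈O eO≡i (inj₂ (inj₁ i∉O)) = ⊥-elim (∈∉⇒≢ {C = O} i∈O i∉O refl)
    -- For `x` above the victim of `S`, saturation applies. For `x` above `q i` only, `O` exchanges
    -- a counted page, namely `i`, and that unit pays for the miss. Otherwise nothing is counted in
    -- `O` beforehand.
    S-only i∉S max i∈O eO≡i (inj₂ (inj₂ min)) with <-≤-connex (q eS) x | <-≤-connex (q i) x
    ... | inj₁ eS<x | _ = from-dominance 1 0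
      (≤-trans (gap i∉S i∈O min) (≤-trans (m≤m+n K 0) (m≤m+n (K + 0) b))) (saturated i∉S max x eS<x)
    ... | inj₂ x≤eS | inj₁ i<x = from-balance 1 0
      (trans (cong (below x ∘ q) eO≡i) (<⇒below≡1 i<x)) (≥⇒below≡0 x≤eS) (s≤s z≤n)
    ... | inj₂ x≤eS | inj₂ x≤i = from-dominance 1 0
      (≤-trans (gap i∉S i∈O min) (≤-trans (m≤m+n K 0) (m≤m+n (K + 0) b))) (begin
      o′                       ≤⟨ m≤m+n o′ _ ⟩
      o′ + below x (q eO)      ≡⟨ 𝕆.exchange _ _ (agree x) ⟩
      o + below x (h i)        ≡⟨ cong (_+ below x (h i)) (weight-zero O none) ⟩
      below x (h i)            ≤⟨ m≤n+m _ s ⟩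
      s + below x (h i)        ≡⟨ 𝕊.exchange _ _ (agree x) ⟨
      s′ + below x (q eS)      ≡⟨ cong (s′ +_) (≥⇒below≡0 x≤eS) ⟩
      s′ + 0                   ≡⟨ +-identityʳ s′ ⟩
      s′                       ∎)
      where
      none : ∀ j → inCache O j ≡ true → below x (q j) ≡ 0
      none j _ with j ≟ i
      ... | yes refl = ≥⇒below≡0 x≤i
      ... | no j≢i   = ≥⇒below≡0 (≤-trans x≤i (<⇒≤ (min j j≢i)))

    by-cases : (inCache S i ≡ true × missed S i ≡ 0 × eS ≡ i)
               ⊎ (inCache S i ≡ false × missed S i ≡ 1 × (∀ j → inCache S j ≡ true → h j ≤ h eS)) →
               (inCache O i ≡ true × missed O i ≡ 0 × eO ≡ i)
               ⊎ (inCache O i ≡ false × missed O i ≡ 1 × (∀ j → inCache O j ≡ true → scoreO j ≤ scoreO eO)) →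
               Goal (missed S i) (missed O i)
    by-cases (inj₁ (_ , mS , eS≡i)) (inj₁ (_ , mO , eO≡i)) rewrite mS | mO =
      from-balance 0 0 (cong (below x ∘ q) eO≡i) (cong (below x ∘ q) eS≡i) (m≤m+n _ b)
    by-cases (inj₁ (_ , mS , _)) (inj₂ (_ , mO , _)) rewrite mS | mO =
      from-balance 0 1 refl refl (≤-trans (below≤1 x (q eS)) (≤-trans (m≤m+n 1 b) (m≤n+m (1 + b) _)))
    by-cases (inj₂ (i∉S , mS , max)) (inj₁ (i∈O , mO , eO≡i)) rewrite mS | mO =
      S-only i∉S max i∈O eO≡i safe
    -- Both misses cancel; only a victim of `S` under `x` could do harm, and then `S` is saturated.
    by-cases (inj₂ (i∉S , mS , max)) (inj₂ (_ , mO , _)) rewrite mS | mO with <-≤-connex (q eS) x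
    ... | inj₁ eS<x = from-dominance 1 1 (≤-trans (+-monoˡ-≤ 1 L≤K) (m≤m+n (K + 1) b)) (saturated i∉S max x eS<x)
    ... | inj₂ x≤eS = from-balance 1 1 refl (≥⇒below≡0 x≤eS) (≤-trans (m≤m+n 1 b) (m≤n+m (1 + b) _))

-- Next arrival times

aug-request : ∀ {n T} {σ : ℕ → Fin n} {t} → 1 ≤ t → t ≤ T → aug n T σ t ≡ just (σ t)
aug-request {n} {T} {σ} {t} 1≤t t≤T with 1 ≤? t | t ≤? T
... | yes _   | yes _   = refl
... | yes _   | no t≰T  = ⊥-elim (t≰T t≤T)
... | no 1≰t  | _       = ⊥-elim (1≰t 1≤t)

aug-virtual : ∀ {n T} {σ : ℕ → Fin n} i → aug n T σ (suc T + toℕ i) ≡ just i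
aug-virtual {n} {T} {σ} i with 1 ≤? suc T + toℕ i | suc T + toℕ i ≤? T
... | no 1≰ | _ = ⊥-elim (1≰ (s≤s z≤n))
... | yes _ | yes le = ⊥-elim (<-irrefl refl (≤-trans (m≤m+n (suc T) (toℕ i)) le))
... | yes _ | no _ with suc T + toℕ i ∸ suc T <? n
...   | yes lt = cong just (toℕ-injective (trans (toℕ-fromℕ< lt) (m+n∸m≡n (suc T) (toℕ i))))
...   | no ≮n  = ⊥-elim (≮n (subst (_< n) (sym (m+n∸m≡n (suc T) (toℕ i))) (toℕ<n i)))

matches-refl : ∀ {n} (i : Fin n) → matches (just i) i ≡ true
matches-refl i = dec-true (i ≟ i) refl

searchFrom-≥ : ∀ n T (σ : ℕ → Fin n) i s f → s ≤ searchFrom n T σ i s f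
searchFrom-≥ n T σ i s zero = ≤-refl
searchFrom-≥ n T σ i s (suc f) with matches (aug n T σ s) i
... | true  = ≤-refl
... | false = ≤-trans (n≤1+n s) (searchFrom-≥ n T σ i (suc s) f)

-- An arrival `r` inside the window stops the search before the extra unit of fuel is reached. This
-- aligns the search windows of consecutive rounds.
searchFrom-fuel : ∀ n T (σ : ℕ → Fin n) i s f {r} → aug n T σ r ≡ just i → s ≤ r → r < s + f →
                  searchFrom n T σ i s (suc f) ≡ searchFrom n T σ i s f
searchFrom-fuel n T σ i s zero {r} _ s≤r r<s+0 =
  ⊥-elim (<-irrefl refl (≤-<-trans s≤r (subst (r <_) (+-identityʳ s) r<s+0)))
searchFrom-fuel n T σ i s (suc f) {r} hit s≤r r<s+f with matches (aug n T σ s) i in miss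
... | true  = refl
... | false = searchFrom-fuel n T σ i (suc s) f hit (≤∧≢⇒< s≤r s≢r) (subst (r <_) (+-suc s f) r<s+f)
  where
  s≢r : s ≢ r
  s≢r refl with trans (sym miss) (trans (cong (λ m → matches m i) hit) (matches-refl i))
  ... | ()

NAT-> : ∀ n T (σ : ℕ → Fin n) t i → t < NAT n T σ t i
NAT-> n T σ t i = searchFrom-≥ n T σ i (suc t) (T + n)

NAT-requested : ∀ n T (σ : ℕ → Fin n) t → suc t ≤ T → NAT n T σ t (σ (suc t)) ≡ suc t
NAT-requested n T@(suc _) σ t t<T
  rewrite aug-request {n} {T} {σ} {suc t} (s≤s z≤n) t<T | matches-refl (σ (suc t)) = refl

NAT-unrequested : ∀ n T (σ : ℕ → Fin n) t {j} → suc t ≤ T → j ≢ σ (suc t) →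
                  NAT n T σ t j ≡ NAT n T σ (suc t) j
NAT-unrequested n T@(suc T′) σ t {j} t<T j≢
  rewrite aug-request {n} {T} {σ} {suc t} (s≤s z≤n) t<T | dec-false (σ (suc t) ≟ j) (j≢ ∘ sym) =
  -- The virtual request of `j` is the arrival that certainly lies in the window.
  sym (searchFrom-fuel n T σ j (2 + t) (T′ + n) {suc T + toℕ j} (aug-virtual {T = T} {σ} j)
    (≤-trans (s≤s t<T) (m≤m+n (suc T) (toℕ j)))
    (s≤s (s≤s (≤-trans (+-monoʳ-< T′ (toℕ<n j)) (m≤n+m (T′ + n) t)))))

-- Remedy predictions

Expires : ∀ {n} → ℕ → ℕ → Fin n → (Fin n → ℕ) → Fin n → Set
Expires Z t i prev j = prev j ≤ t × prev j ≤ prev i × prev i < Z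

hatp-requested : ∀ n (σ : ℕ → Fin n) p Z t → hatp n σ p Z (suc t) (σ (suc t)) ≡ p (suc t)
hatp-requested n σ p Z zero    rewrite dec-true (σ 1 ≟ σ 1) refl = refl
hatp-requested n σ p Z (suc t) rewrite dec-true (σ (2 + t) ≟ σ (2 + t)) refl = refl

-- Since every value at time 0 is `suc Z`, round one obeys the general rule too: expiry would need
-- the old value of the request to be under `Z`.
hatp-unrequested : ∀ n (σ : ℕ → Fin n) p Z t {j} → j ≢ σ (suc t) →
  let prev = hatp n σ p Z t
      E    = Expires Z (suc t) (σ (suc t)) prev j
  in (hatp n σ p Z (suc t) j ≡ Z × E) ⊎ (hatp n σ p Z (suc t) j ≡ prev j × ¬ E)
hatp-unrequested n σ p Z zero {j} j≢ rewrite dec-false (j ≟ σ 1) j≢ =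
  inj₂ (refl , λ { (_ , _ , 1+Z<Z) → <-irrefl refl (<-trans (n<1+n Z) 1+Z<Z) })
hatp-unrequested n σ p Z (suc t) {j} j≢ rewrite dec-false (j ≟ σ (2 + t)) j≢ =
  -- The Boolean test of `hatpStep` is definitionally the `does` of this product decision.
  if-dec ((prev j ≤? 2 + t) ×-dec ((prev j ≤? prev (σ (2 + t))) ×-dec (prev (σ (2 + t)) <? Z))) Z (prev j)
  where
  prev : Fin n → ℕ
  prev = hatp n σ p Z (suc t)

-- Counting rounds

countRounds-suc : ∀ t b → countRounds (suc t) b ≡ countRounds t b + ind (b (suc t))
countRounds-suc t b = begin
  count (map suc (upTo (suc t)))                    ≡⟨ cong (count ∘ map suc) (upTo-∷ʳ t) ⟨
  count (map suc (upTo t ++ t ∷ []))                ≡⟨ cong count (map-++ suc (upTo t) (t ∷ [])) ⟩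
  count (map suc (upTo t) ++ suc t ∷ [])            ≡⟨ cong length (filter-++ (T? ∘ b) (map suc (upTo t)) (suc t ∷ [])) ⟩
  length (filter (T? ∘ b) (map suc (upTo t)) ++ filter (T? ∘ b) (suc t ∷ []))
                                                    ≡⟨ length-++ (filter (T? ∘ b) (map suc (upTo t))) ⟩
  countRounds t b + count (suc t ∷ [])              ≡⟨ cong (countRounds t b +_) last ⟩
  countRounds t b + ind (b (suc t))                 ∎
  where
  open ≡-Reasoning
  count = length ∘ filter (T? ∘ b)
  last : count (suc t ∷ []) ≡ ind (b (suc t))
  last with b (suc t)
  ... | true  = refl
  ... | false = refl

-- Credits

-- A suspect page carries 2 credits for the round that requests it and, while
-- its remedy prediction is still below Z, one more for its expiry.
credit : ℕ → Bool → ℕ → ℕ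
credit Z bad a = if bad then 2 + below Z a else 0

credits : ∀ {n} → ℕ → (Fin n → Bool) → (Fin n → ℕ) → ℕ
credits Z bad h = sum (λ j → credit Z (bad j) (h j))

credit≤3 : ∀ Z b a → credit Z b a ≤ 3 * ind b
credit≤3 Z true  a = s≤s (s≤s (below≤1 Z a))
credit≤3 Z false a = z≤n

credit≥2 : ∀ Z b a → 2 * ind b ≤ credit Z b a
credit≥2 Z true  a = s≤s (s≤s z≤n)
credit≥2 Z false a = z≤n

-- Raising a page from `h` to `Z` can only lower the count of `O`; it lowers that of `S` by at most
-- one, paid for by the expiry credit of the page.
expire : ∀ {n} Z (bad : Fin n → Bool) (h q : Fin n → ℕ) →
         (∀ j → q j ≡ h j ⊎ (q j ≡ Z × h j < Z × bad j ≡ true)) → (O S : Subset n) → ∀ x →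
         credits Z bad q + weight O (below x ∘ q) + weight S (below x ∘ h)
         ≤ credits Z bad h + weight O (below x ∘ h) + weight S (below x ∘ q)
expire {n} Z bad h q change O S x =
  subst₂-≤ (distrib₃ (c q) (m O q) (m S h)) (distrib₃ (c h) (m O h) (m S q)) (sum-mono pointwise)
  where
  c : (Fin n → ℕ) → Fin n → ℕ
  c g j = credit Z (bad j) (g j)
  m : Subset n → (Fin n → ℕ) → Fin n → ℕ
  m C g j = mem C j * below x (g j)

  subst₂-≤ : ∀ {a b a′ b′} → a ≡ a′ → b ≡ b′ → a ≤ b → a′ ≤ b′
  subst₂-≤ refl refl a≤b = a≤b

  distrib₃ : ∀ (f g k : Fin n → ℕ) → sum (λ j → f j + g j + k j) ≡ sum f + sum g + sum k
  distrib₃ f g k = trans (∑-distrib-+ (λ j → f j + g j) k) (cong (_+ sum k) (∑-distrib-+ f g))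

  mem*below≤1 : ∀ C j a → mem C j * below x a ≤ 1
  mem*below≤1 C j a = *-mono-≤ (ind≤1 (inCache C j)) (below≤1 x a)

  pointwise : ∀ j → c q j + m O q j + m S h j ≤ c h j + m O h j + m S q j
  pointwise j with change j
  ... | inj₁ qj≡hj rewrite qj≡hj = ≤-refl
  ... | inj₂ (qj≡Z , hj<Z , bj) rewrite bj | qj≡Z | <⇒below≡1 hj<Z | ≥⇒below≡0 (≤-refl {Z}) = begin
    2 + mem O j * below x Z + m S h j   ≤⟨ +-mono-≤ (+-monoʳ-≤ 2 (*-monoʳ-≤ (mem O j) (below-anti x (<⇒≤ hj<Z)))) (mem*below≤1 S j (h j)) ⟩
    2 + m O h j + 1                     ≡⟨ +-comm (2 + m O h j) 1 ⟩
    3 + m O h j                         ≤⟨ m≤m+n (3 + m O h j) _ ⟩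
    3 + m O h j + mem S j * below x Z   ∎
    where open ≤-Reasoning

-- Amortized comparison of Sim with FitF by induction over the rounds

module _ {n k T : ℕ} (σ : ℕ → Fin n) (C₀ : Subset n) (∣C₀∣≡k : ∣ C₀ ∣ ≡ k)
         (p : ℕ → ℕ) (Z : ℕ) (T+n<Z : T + n < Z) (S O : ℕ → Subset n)
         (runS : IsSimRun n T σ p Z C₀ S) (runO : IsFitFRun n T σ C₀ O)
  where

  private
    ĥ : ℕ → Fin n → ℕ
    ĥ = hatp n σ p Z

    wrong : ℕ → Bool
    wrong t = if does (p t Data.Nat.≟ NAT n T σ t (σ t)) then false else true

    η : ℕ → ℕ
    η t = countRounds t wrong

    costS costO : ℕ → ℕ
    costS t = cost n t σ S
    costO t = cost n t σ O

  -- Pages whose remedy prediction may differ from the true NAT: those with a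
  -- wrong last prediction, and the initial cache until its first requests.
  suspect : ℕ → Fin n → Bool
  suspect zero    j = inCache C₀ j
  suspect (suc t) j = if does (j ≟ σ (suc t)) then wrong (suc t) else suspect t j

  -- Quantifying `bound` over `x` replaces the maximum over thresholds. Caches carry the index
  -- `suc t` because they are indexed by the start of a round.
  record Invariant (t : ℕ) : Set where
    field
      sizes   : size (O (suc t)) ≡ size (S (suc t))
      trusted : ∀ j → suspect t j ≡ false →
                (ĥ t j ≡ suc Z × inCache (O (suc t)) j ≡ false) ⊎ ĥ t j ≡ NAT n T σ t j
      bound   : ∀ x → costS t + credits Z (suspect t) (ĥ t) + weight (O (suc t)) (below x ∘ ĥ t)
                    ≤ costO t + 3 * η t + 2 * k + weight (S (suc t)) (below x ∘ ĥ t)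

  invariant-zero : Invariant 0
  invariant-zero = record
    { sizes   = cong size O₁≡S₁
    ; trusted = λ j j∉C₀ → inj₁ (refl , trans (cong (λ C → inCache C j) (proj₁ runO)) j∉C₀)
    ; bound   = λ x → +-mono-≤ (≤-reflexive initial-credits)
                        (≤-reflexive (cong (λ C → weight C (below x ∘ ĥ 0)) O₁≡S₁))
    }
    where
    open ≡-Reasoning
    O₁≡S₁ : O 1 ≡ S 1
    O₁≡S₁ = trans (proj₁ runO) (sym (proj₁ runS))
    pointwise : ∀ j → credit Z (inCache C₀ j) (suc Z) ≡ mem C₀ j * 1 + mem C₀ j * 1
    pointwise j with inCache C₀ j
    -- The initial value `suc Z` is not under `Z`, so an initial page carries no expiry credit.
    ... | true  = cong (2 +_) (≥⇒below≡0 (n≤1+n Z))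
    ... | false = refl
    initial-credits : credits Z (inCache C₀) (λ _ → suc Z) ≡ 2 * k
    initial-credits = begin
      credits Z (inCache C₀) (λ _ → suc Z)          ≡⟨ sum-cong-≗ pointwise ⟩
      sum (λ j → mem C₀ j * 1 + mem C₀ j * 1)       ≡⟨ ∑-distrib-+ (λ j → mem C₀ j * 1) (λ j → mem C₀ j * 1) ⟩
      size C₀ + size C₀                             ≡⟨ cong (λ m → m + m) (trans (size≡∣∣ C₀) ∣C₀∣≡k) ⟩
      k + k                                         ≡⟨ cong (k +_) (+-identityʳ k) ⟨
      2 * k                                         ∎

  module _ (t : ℕ) (t<T : suc t ≤ T) (I : Invariant t) where
    open Invariant I

    private
      i : Fin n
      i = σ (suc t)

      h h′ q : Fin n → ℕ
      h  = ĥ t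
      h′ = ĥ (suc t)
      -- h′ before the prediction of the requested page is renewed
      q j = if does (j ≟ i) then h i else h′ j

      bad : Fin n → Bool
      bad = suspect t

      S₀ S₁ O₀ O₁ : Subset n
      S₀ = S (suc t)
      S₁ = S (2 + t)
      O₀ = O (suc t)
      O₁ = O (2 + t)

      serveS : Serve S₀ S₁ i h′
      serveS = lazyStep⇒serve σ ĥ S (suc t) (proj₂ runS (suc t) (s≤s z≤n) t<T)

      serveO : Serve O₀ O₁ i (NAT n T σ (suc t))
      serveO = lazyStep⇒serve σ (NAT n T σ) O (suc t) (proj₂ runO (suc t) (s≤s z≤n) t<T)

      t<Z : suc t < Z
      t<Z = ≤-<-trans (≤-trans t<T (m≤m+n T n)) T+n<Z

      q-requested : q i ≡ h i
      q-requested rewrite dec-true (i ≟ i) refl = refl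

      q-unrequested : ∀ j → j ≢ i → q j ≡ h′ j
      q-unrequested j j≢i rewrite dec-false (j ≟ i) j≢i = refl

      -- Hence an overdue page is suspect, and its expiry has a credit to spend.
      trusted-late : ∀ j → j ≢ i → bad j ≡ false → suc t < h j
      trusted-late j j≢i ok with trusted j ok
      ... | inj₁ (new , _) = subst (suc t <_) (sym new) (<-trans t<Z (n<1+n Z))
      ... | inj₂ exact     = subst (suc t <_) (sym (trans exact (NAT-unrequested n T σ t t<T j≢i))) (NAT-> n T σ (suc t) j)

      change : ∀ j → q j ≡ h j ⊎ (q j ≡ Z × h j < Z × bad j ≡ true)
      change j with j ≟ i
      ... | yes refl = inj₁ refl
      ... | no j≢i with hatp-unrequested n σ p Z t j≢i
      ...   | inj₂ (keep , _) = inj₁ keep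
      ...   | inj₁ (reset , hj≤t , _) with bad j in ok
      ...     | true  = inj₂ (reset , ≤-<-trans hj≤t t<Z , refl)
      ...     | false = ⊥-elim (≤⇒≯ hj≤t (trusted-late j j≢i ok))

      -- The request of an exactly predicted page resets all overdue pages.
      exact-min : h i ≡ suc t → ∀ j → j ≢ i → q i < q j
      exact-min hi≡t j j≢i rewrite q-requested | q-unrequested j j≢i | hi≡t
        with hatp-unrequested n σ p Z t j≢i
      ... | inj₁ (reset , _) = subst (suc t <_) (sym reset) t<Z
      ... | inj₂ (keep , live) = subst (suc t <_) (sym keep) (≰⇒> λ hj≤t →
              live (hj≤t , subst (h j ≤_) (sym hi≡t) hj≤t , subst (_< Z) (sym hi≡t) t<Z))

      -- The three kinds of request: a suspect page brings two credits, a page never seen is absent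
      -- from `O`, and an exactly predicted page has the smallest value.
      safe : 2 ≤ 2 * ind (bad i) ⊎ inCache O₀ i ≡ false ⊎ (∀ j → j ≢ i → q i < q j)
      safe with bad i in ok
      ... | true  = inj₁ ≤-refl
      ... | false with trusted i ok
      ...   | inj₁ (_ , i∉O) = inj₂ (inj₁ i∉O)
      ...   | inj₂ exact     = inj₂ (inj₂ (exact-min (trans exact (NAT-requested n T σ t t<T))))

      K : ℕ
      K = costO t + 3 * η t + 2 * k

      -- First half of the round: overdue pages expire while the request keeps its old value.
      expired-bound : ∀ x → costS t + credits Z bad q + weight O₀ (below x ∘ q) ≤ K + weight S₀ (below x ∘ q)
      expired-bound x = +-cancelʳ-≤ (weight S₀ (below x ∘ h)) _ _ (begin
        costS t + credits Z bad q + weight O₀ (below x ∘ q) + sₕ     ≡⟨ r (costS t) _ _ sₕ ⟩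
        costS t + (credits Z bad q + weight O₀ (below x ∘ q) + sₕ)   ≤⟨ +-monoʳ-≤ (costS t) (expire Z bad h q change O₀ S₀ x) ⟩
        costS t + (credits Z bad h + weight O₀ (below x ∘ h) + s_q)  ≡⟨ r (costS t) _ _ s_q ⟨
        costS t + credits Z bad h + weight O₀ (below x ∘ h) + s_q    ≤⟨ +-monoˡ-≤ s_q (bound x) ⟩
        K + sₕ + s_q                                                 ≡⟨ +-swapʳ K sₕ s_q ⟩
        K + s_q + sₕ                                                 ∎)
        where
        open ≤-Reasoning
        sₕ  = weight S₀ (below x ∘ h)
        s_q = weight S₀ (below x ∘ q)
        r : ∀ a b c d → a + b + c + d ≡ a + (b + c + d)
        r = solve-∀

      suspect-requested : suspect (suc t) i ≡ wrong (suc t)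
      suspect-requested rewrite dec-true (i ≟ i) refl = refl

      suspect-unrequested : ∀ j → j ≢ i → suspect (suc t) j ≡ bad j
      suspect-unrequested j j≢i rewrite dec-false (j ≟ i) j≢i = refl

      -- A suspect request gives up its at least two credits; a wrong new prediction buys at most
      -- three.
      credits-renew : credits Z (suspect (suc t)) h′ + 2 * ind (bad i)
                      ≤ credits Z bad q + 3 * ind (wrong (suc t))
      credits-renew = begin
        credits Z (suspect (suc t)) h′ + 2 * ind (bad i)           ≤⟨ +-monoʳ-≤ _ (credit≥2 Z (bad i) (q i)) ⟩
        credits Z (suspect (suc t)) h′ + credit Z (bad i) (q i)    ≡⟨ sum-cong-except i (λ j j≢i → cong₂ (credit Z) (suspect-unrequested j j≢i) (sym (q-unrequested j j≢i))) ⟩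
        credits Z bad q + credit Z (suspect (suc t) i) (h′ i)      ≤⟨ +-monoʳ-≤ _ (credit≤3 Z (suspect (suc t) i) (h′ i)) ⟩
        credits Z bad q + 3 * ind (suspect (suc t) i)              ≡⟨ cong (λ b → credits Z bad q + 3 * ind b) suspect-requested ⟩
        credits Z bad q + 3 * ind (wrong (suc t))                  ∎
        where open ≤-Reasoning

      bound′ : ∀ x → costS (suc t) + credits Z (suspect (suc t)) h′ + weight O₁ (below x ∘ h′)
                   ≤ costO (suc t) + 3 * η (suc t) + 2 * k + weight S₁ (below x ∘ h′)
      bound′ x
        rewrite countRounds-suc t (λ u → if inCache (S u) (σ u) then false else true)
              | countRounds-suc t (λ u → if inCache (O u) (σ u) then false else true)
              | countRounds-suc t wrong
        -- `b` is released by `credits-renew` and consumed in `served`, so it appears on both sides.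
        = +-cancelʳ-≤ b _ _ (begin
        costS t + mS + c′ + o′ + b                    ≡⟨ r₁ (costS t) mS c′ o′ b ⟩
        costS t + mS + o′ + (c′ + b)                  ≤⟨ +-monoʳ-≤ (costS t + mS + o′) credits-renew ⟩
        costS t + mS + o′ + (c + 3 * w)               ≡⟨ r₂ (costS t) mS o′ c (3 * w) ⟩
        costS t + c + mS + o′ + 3 * w                 ≤⟨ +-monoˡ-≤ (3 * w) served ⟩
        K + mO + b + s′ + 3 * w                       ≡⟨ r₃ (costO t) (η t) k mO b s′ w ⟩
        costO t + mO + 3 * (η t + w) + 2 * k + s′ + b ∎)
        where
        open ≤-Reasoning
        mS = missed S₀ i
        mO = missed O₀ i
        b  = 2 * ind (bad i)
        w  = ind (wrong (suc t))
        c  = credits Z bad q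
        c′ = credits Z (suspect (suc t)) h′
        o′ = weight O₁ (below x ∘ h′)
        s′ = weight S₁ (below x ∘ h′)
        served : costS t + c + mS + o′ ≤ K + mO + b + s′
        served = round S₀ S₁ O₀ O₁ i q h′ _ q-unrequested serveS serveO sizes
                   (costS t + c) K expired-bound safe x
        r₁ : ∀ a m c o b → a + m + c + o + b ≡ a + m + o + (c + b)
        r₁ = solve-∀
        r₂ : ∀ a m o c w → a + m + o + (c + w) ≡ a + c + m + o + w
        r₂ = solve-∀
        r₃ : ∀ a e k m b s w → a + 3 * e + 2 * k + m + b + s + 3 * w ≡ a + m + 3 * (e + w) + 2 * k + s + b
        r₃ = solve-∀

      trusted′ : ∀ j → suspect (suc t) j ≡ false →
                 (h′ j ≡ suc Z × inCache O₁ j ≡ false) ⊎ h′ j ≡ NAT n T σ (suc t) j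
      trusted′ j ok with j ≟ i
      trusted′ j ok | yes refl with if-dec (p (suc t) Data.Nat.≟ NAT n T σ (suc t) i) false true
      ... | inj₁ (_ , exact) = inj₂ (trans (hatp-requested n σ p Z t) exact)
      ... | inj₂ (bad , _) with trans (sym ok) bad
      ...   | ()
      trusted′ j ok | no j≢i with hatp-unrequested n σ p Z t j≢i
      ... | inj₁ (_ , hj≤t , _) = ⊥-elim (≤⇒≯ hj≤t (trusted-late j j≢i ok))
      ... | inj₂ (keep , _) with trusted j ok
      ...   | inj₁ (new , j∉O) = inj₁ (trans keep new , Serve.stays-out serveO j≢i j∉O)
      ...   | inj₂ exact       = inj₂ (trans keep (trans exact (NAT-unrequested n T σ t t<T j≢i)))

    invariant-suc : Invariant (suc t)
    invariant-suc = record
      { sizes   = trans (size-serve serveO) (trans sizes (sym (size-serve serveS)))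
      ; trusted = trusted′
      ; bound   = bound′
      }

  invariant : ∀ t → t ≤ T → Invariant t
  invariant zero    _   = invariant-zero
  invariant (suc t) t<T = invariant-suc t t<T (invariant t (<⇒≤ t<T))

  cost-bound : cost n T σ S ≤ cost n T σ O + 3 * (eta n T σ p + k)
  cost-bound = begin
    costS T                                             ≤⟨ ≤-trans (m≤m+n _ _) (m≤m+n _ _) ⟩
    costS T + credits Z (suspect T) (ĥ T) + weight (O (suc T)) (below 0 ∘ ĥ T)
                                                        -- Threshold 0 removes the cache of Sim from
                                                        -- the final bound.
                                                        ≤⟨ Invariant.bound (invariant T ≤-refl) 0 ⟩
    costO T + 3 * η T + 2 * k + weight (S (suc T)) (below 0 ∘ ĥ T)
                                                        ≡⟨ cong (costO T + 3 * η T + 2 * k +_) (weight-zero (S (suc T)) λ j _ → ≥⇒below≡0 {0} {ĥ T j} z≤n) ⟩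
    -- One more `k` rounds the bound up to a common factor 3.
    costO T + 3 * η T + 2 * k + 0                       ≤⟨ +-monoʳ-≤ (costO T + 3 * η T + 2 * k) (z≤n {k}) ⟩
    costO T + 3 * η T + 2 * k + k                       ≡⟨ r (costO T) (η T) k ⟩
    costO T + 3 * (η T + k)                             ∎
    where
    open ≤-Reasoning
    r : ∀ a e k → a + 3 * e + 2 * k + k ≡ a + 3 * (e + k)
    r = solve-∀

theorem2 : Σ ℕ λ c → 0 < c ×
    (∀ (n k T : ℕ) → k < n → (σ : ℕ → Fin n) → (C₀ : Subset n) → ∣ C₀ ∣ ≡ k
    → (p : ℕ → ℕ) → (∀ t → 1 ≤ t → t ≤ T → t < p t × p t ≤ T + n)
    → (Z : ℕ) → T + n < Z
    → (S O : ℕ → Subset n)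
    → IsSimRun n T σ p Z C₀ S → IsFitFRun n T σ C₀ O
    → cost n T σ S ≤ cost n T σ O + c * (eta n T σ p + k))
-- Three credits per wrong prediction: two for the next request of the page and one for its expiry.
theorem2 = 3 , s≤s z≤n ,
  λ n k T _ σ C₀ ∣C₀∣≡k p _ Z T+n<Z S O runS runO →
    cost-bound σ C₀ ∣C₀∣≡k p Z T+n<Z S O runS runO
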